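{- Let $u\ge1$ be an integer, $0<p\le1$, $q=1-p$, and consider the single-player pile game with boundary with set of choices $R=\{1,-u\}$, with generating functions $G_{n,s}(x)$, $0\le s\le n$. For $0\le s\le n$ write $G_{n,s}(x)=\dfrac{P_{n,s}(x)}{Q_n(x)}$, where $Q_n(x)$ is the common denominator (independent of $s$), normalized so that the numerator of $G_{n,0}(x)$ is $P_{n,0}(x)=(px)^n$, and the $P_{n,s}(x)$ are polynomials. Then $Q_n(x)$ satisfies $$Q_n(x)=Q_{n-1}(x)-q\,p^u x^{u+1}\,Q_{n-u-1}(x)\qquad(n\ge u+1).$$
   Context: Single-player pile game with boundary, $R=\{1,-u\}$: the player starts with $s$ chips, $0\le s\le n$. In each turn, independently, the number of chips $c$ is replaced by $c+1$ with probability $p$ and by $\max(0,c-u)$ with probability $q=1-p$. The game ends when the player first has $n$ chips (at turn $0$ if $s=n$). $B_n(k,s)$ is the probability that the game ends at the $k$-th turn, and $G_{n,s}(x)=\sum_{k\ge0}B_n(k,s)x^k$. In particular $G_{n,n}(x)=1$ for all $n\ge0$. The functions $G_{n,s}(x)$, $0\le s\le n$, are rational with a common denominator. -}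

module Defs where

open import Level as Level using (Level; _⊔_)
open import Algebra.Bundles using (CommutativeRing; RawRing)
open import Algebra.Apartness.Bundles using (HeytingField; HeytingCommutativeRing)
import Algebra.Definitions.RawSemiring as RawSemiringDefinitions
open import Data.Bool.Base using (Bool; not; _∧_; if_then_else_)
open import Data.Fin.Base using (toℕ)
open import Data.List.Base as List using (List; []; _∷_; _++_)
open import Data.Nat.Base as ℕ using (ℕ; zero; suc; _∸_)
open import Data.Nat.Properties using (_≟_)
open import Data.Product.Base using (∃-syntax; _×_)
open import Data.Sum.Base using (_⊎_)
open import Data.Vec.Base as Vec using (Vec; []; _∷_)
open import Function.Bundles using (_⇔_)
open import Relation.Binary.Core using (Rel)
open import Relation.Binary.Structures using (IsStrictPartialOrder)
open import Relation.Nullary using (¬_; does)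

private
  variable
    c ℓ ℓ₁ ℓ₂ ℓ₃ : Level

-- The field of probabilities.  The axioms hold for the Dedekind or Cauchy
-- reals constructively, so the order is not assumed to be decidable or
-- trichotomous: apartness is "less or greater", and cotransitivity and
-- tightness are inherited from the Heyting field.
record OrderedField c ℓ₁ ℓ₂ ℓ₃ : Set (Level.suc (c ⊔ ℓ₁ ⊔ ℓ₂ ⊔ ℓ₃)) where
  field
    heytingField : HeytingField c ℓ₁ ℓ₂

  open HeytingField heytingField public

  infix 4 _<_ _≤_
  field
    _<_                  : Rel Carrier ℓ₃
    isStrictPartialOrder : IsStrictPartialOrder _≈_ _<_
    #⇔<⊎>                : ∀ x y → x # y ⇔ (x < y ⊎ y < x)
    +-monoˡ-<            : ∀ z {x y} → x < y → x + z < y + z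
    *-pos                : ∀ {x y} → 0# < x → 0# < y → 0# < x * y

  _≤_ : Rel Carrier ℓ₃
  x ≤ y = ¬ (y < x)

  open CommutativeRing (HeytingCommutativeRing.commutativeRing heytingCommutativeRing) public
    using (rawRing)

  open RawSemiringDefinitions (RawRing.rawSemiring rawRing) public using (_^_)

-- Formal power series, given by their coefficients.  Polynomials are the
-- series with only finitely many nonzero coefficients.
module PowerSeries (R : RawRing c ℓ) where
  open RawRing R
  open RawSemiringDefinitions rawSemiring using (sum)

  infix  4 _≈ₛ_ _≈ₛ_/_
  infixl 6 _+ₛ_ _-ₛ_
  infixl 7 _*ₛ_
  infix  8 -ₛ_

  Series : Set c
  Series = ℕ → Carrier

  _≈ₛ_ : Rel Series ℓ
  f ≈ₛ g = ∀ k → f k ≈ g k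

  const : Carrier → Series
  const a zero    = a
  const a (suc _) = 0#

  X : Series
  X 1 = 1#
  X _ = 0#

  0ₛ 1ₛ : Series
  0ₛ = const 0#
  1ₛ = const 1#

  _+ₛ_ _-ₛ_ _*ₛ_ : Series → Series → Series
  (f +ₛ g) k = f k + g k
  (f -ₛ g) k = f k + - g k
  (f *ₛ g) k = sum {suc k} λ i → f (toℕ i) * g (k ∸ toℕ i)

  -ₛ_ : Series → Series
  (-ₛ f) k = - f k

  seriesRawRing : RawRing c ℓ
  seriesRawRing = record
    { _≈_ = _≈ₛ_ ; _+_ = _+ₛ_ ; _*_ = _*ₛ_ ; -_ = -ₛ_ ; 0# = 0ₛ ; 1# = 1ₛ }

  open RawSemiringDefinitions (RawRing.rawSemiring seriesRawRing) public
    using () renaming (_^_ to infixr 8 _^ₛ_)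

  IsPolynomial : Series → Set ℓ
  IsPolynomial f = ∃[ d ] (∀ k → d ℕ.≤ k → f k ≈ 0#)

  -- The series f is the expansion of the quotient g / h.
  _≈ₛ_/_ : Series → Series → Series → Set ℓ
  f ≈ₛ g / h = ¬ (h ≈ₛ 0ₛ) × h *ₛ f ≈ₛ g

data Choice : Set where
  gain lose : Choice

choices : ∀ k → List (Vec Choice k)
choices zero    = [] ∷ []
choices (suc k) = List.map (gain ∷_) (choices k) ++ List.map (lose ∷_) (choices k)

-- The pile game with boundary with R = {1, -u}, where p is the probability
-- of choosing 1.
module PileGame (K : OrderedField c ℓ₁ ℓ₂ ℓ₃) (u : ℕ) (p : OrderedField.Carrier K) where
  open OrderedField K
  open PowerSeries rawRing public

  q : Carrier
  q = 1# - p

  move : Choice → ℕ → ℕ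
  move gain chips = suc chips
  move lose chips = chips ∸ u

  -- Starting with s chips and choosing w, the player has n chips after the
  -- last turn of w, and at no earlier time.
  endsAfter : (n s : ℕ) → ∀ {k} → Vec Choice k → Bool
  endsAfter n s []       = does (s ≟ n)
  endsAfter n s (x ∷ w) = not (does (s ≟ n)) ∧ endsAfter n (move x s) w

  weight : Choice → Carrier
  weight gain = p
  weight lose = q

  -- Turns are independent, so a sequence of choices has the product weight.
  probability : ∀ {k} → Vec Choice k → Carrier
  probability w = Vec.foldr′ _*_ 1# (Vec.map weight w)

  Pr : ∀ k → (Vec Choice k → Bool) → Carrier
  Pr k event =
    List.foldr _+_ 0# (List.map (λ w → if event w then probability w else 0#) (choices k))

  B : (n k s : ℕ) → Carrier
  B n k s = Pr k (endsAfter n s)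

  G : (n s : ℕ) → Series
  G n s k = B n k s

  -- The values P n s with s > n are irrelevant.
  record IsNormalizedRepresentation (P : ℕ → ℕ → Series) (Q : ℕ → Series) : Set ℓ₁ where
    field
      numerator-polynomial   : ∀ n s → s ℕ.≤ n → IsPolynomial (P n s)
      denominator-polynomial : ∀ n → IsPolynomial (Q n)
      fraction               : ∀ n s → s ℕ.≤ n → G n s ≈ₛ P n s / Q n
      normalized             : ∀ n → P n 0 ≈ₛ (const p *ₛ X) ^ₛ n

{-# OPTIONS --safe #-}

-- Put y = p X and let D n be given by D 0 = 1 and
-- D (n+1) = D n - q X y^{min(n,u)} D (n∸u).  For s < n the series G n s satisfy
-- the first-step equations F s = y F (s+1) + q X F (s∸u), and multiplying the
-- recurrence of D by y^{n-s} shows that so do the series y^{n-s} D s.  Every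
-- term on the right carries a factor X, so a solution is determined by F n,
-- and D n * G n s = y^{n-s} D s follows on comparing at s = n.  Conversely, a
-- denominator Q n with numerator y^n at s = 0 has
-- y^n Q n = D n G n 0 Q n = y^n D n, whence Q n = D n.
module Submission where

open import Defs
open import Algebra.Bundles using (CommutativeRing)
open import Algebra.Apartness.Bundles using (HeytingCommutativeRing)
import Algebra.Apartness.Properties.HeytingCommutativeRing as HeytingProperties
import Algebra.Properties.CommutativeSemiring.Exp as Exponentiation
import Algebra.Properties.Group as GroupProperties
import Algebra.Properties.Semiring.Exp as SemiringExponentiation
import Algebra.Solver.Ring.NaturalCoefficients.Default as SemiringSolver
open import Data.Bool.Base using (Bool; true; false; not; _∧_; if_then_else_)
open import Data.List.Base as List using (List; []; _∷_; _++_)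
open import Data.List.Properties using (map-∘)
open import Data.Nat.Base as ℕ using (ℕ; zero; suc; _∸_; z≤n; s≤s)
import Data.Nat.Properties as ℕ
open import Data.Product.Base using (∃-syntax; _×_; _,_; proj₂)
open import Data.Sum.Base using (inj₁; inj₂)
open import Data.Vec.Base using (Vec; []; _∷_)
open import Function.Base using (_∘_)
open import Function.Bundles using (Equivalence)
open import Relation.Binary.PropositionalEquality as ≡ using (_≡_)
import Relation.Binary.Reasoning.Setoid as ≈-Reasoning
open import Relation.Nullary using (¬_; does)
open import Relation.Nullary.Decidable using (dec-true; dec-false)

-- Power series over a commutative ring form a commutative ring.

module SeriesRing {c ℓ} (R : CommutativeRing c ℓ) where
  open CommutativeRing R hiding (zero)
  open PowerSeries rawRing
  open SemiringSolver commutativeSemiring using (solve; _:=_; _:+_; _:*_)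
  open ≈-Reasoning setoid

  private
    variable
      f f′ g g′ : Series

  -- By definition `(f *ₛ g) (suc k)` unfolds to `f 0 * g (suc k) + (tail f *ₛ g) k`, so proofs
  -- about products go by induction on the coefficient index, passing to the tail of the left
  -- factor.
  tail : Series → Series
  tail f = f ∘ suc

  infixr 7 _•_
  _•_ : Carrier → Series → Series
  (a • f) k = a * f k

  *ₛ-cong : f ≈ₛ f′ → g ≈ₛ g′ → f *ₛ g ≈ₛ f′ *ₛ g′
  *ₛ-cong p q zero    = +-congʳ (*-cong (p 0) (q 0))
  *ₛ-cong p q (suc k) = +-cong (*-cong (p 0) (q (suc k))) (*ₛ-cong (p ∘ suc) q k)

  -- The congruence factor is explicit since series products unfold, which
  -- defeats its inference.
  *ₛ-congˡ : ∀ f → g ≈ₛ g′ → f *ₛ g ≈ₛ f *ₛ g′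
  *ₛ-congˡ f q = *ₛ-cong {f} (λ _ → refl) q

  *ₛ-congʳ : ∀ g → f ≈ₛ f′ → f *ₛ g ≈ₛ f′ *ₛ g
  *ₛ-congʳ g p = *ₛ-cong {g = g} p (λ _ → refl)

  -- `const` is defined by cases on the index, so `0ₛ k` does not reduce for a variable `k`.
  0ₛ-coefficient : ∀ k → 0ₛ k ≈ 0#
  0ₛ-coefficient zero    = refl
  0ₛ-coefficient (suc k) = refl

  -- The coefficientwise hypothesis passes to tails and also fits `tail (const a)`, which is not
  -- literally `0ₛ`.
  *ₛ-zeroˡ : (∀ k → f k ≈ 0#) → ∀ g k → (f *ₛ g) k ≈ 0#
  *ₛ-zeroˡ f≈0 g zero    = trans (+-identityʳ _) (trans (*-congʳ (f≈0 0)) (zeroˡ _))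
  *ₛ-zeroˡ f≈0 g (suc k) =
    trans (+-cong (trans (*-congʳ (f≈0 0)) (zeroˡ _)) (*ₛ-zeroˡ (f≈0 ∘ suc) g k)) (+-identityˡ 0#)

  *ₛ-distribʳ : ∀ h f g → (f +ₛ g) *ₛ h ≈ₛ f *ₛ h +ₛ g *ₛ h
  *ₛ-distribʳ h f g zero    = begin
    (f 0 + g 0) * h 0 + 0#
      ≈⟨ +-cong (distribʳ (h 0) (f 0) (g 0)) (sym (+-identityˡ 0#)) ⟩
    (f 0 * h 0 + g 0 * h 0) + (0# + 0#)
      ≈⟨ solve 3 (λ F G z → (F :+ G) :+ (z :+ z) := (F :+ z) :+ (G :+ z)) refl _ _ _ ⟩
    (f *ₛ h +ₛ g *ₛ h) 0 ∎
  *ₛ-distribʳ h f g (suc k) = begin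
    (f 0 + g 0) * h (suc k) + ((tail f +ₛ tail g) *ₛ h) k
      ≈⟨ +-congˡ (*ₛ-distribʳ h (tail f) (tail g) k) ⟩
    (f 0 + g 0) * h (suc k) + ((tail f *ₛ h) k + (tail g *ₛ h) k)
      ≈⟨ solve 5 (λ f₀ g₀ hₖ F G →
           (f₀ :+ g₀) :* hₖ :+ (F :+ G) := (f₀ :* hₖ :+ F) :+ (g₀ :* hₖ :+ G))
           refl _ _ _ _ _ ⟩
    (f *ₛ h +ₛ g *ₛ h) (suc k) ∎

  •-*ₛ-assoc : ∀ a f g → (a • f) *ₛ g ≈ₛ a • (f *ₛ g)
  •-*ₛ-assoc a f g zero    = begin
    a * f 0 * g 0 + 0#     ≈⟨ +-identityʳ _ ⟩
    a * f 0 * g 0          ≈⟨ *-assoc _ _ _ ⟩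
    a * (f 0 * g 0)        ≈⟨ *-congˡ (+-identityʳ _) ⟨
    a * (f 0 * g 0 + 0#)   ∎
  •-*ₛ-assoc a f g (suc k) = begin
    a * f 0 * g (suc k) + ((a • tail f) *ₛ g) k
      ≈⟨ +-cong (*-assoc _ _ _) (•-*ₛ-assoc a (tail f) g k) ⟩
    a * (f 0 * g (suc k)) + a * (tail f *ₛ g) k
      ≈⟨ distribˡ _ _ _ ⟨
    a * (f *ₛ g) (suc k) ∎

  -- The tail of `f *ₛ g` is `f 0 • tail g +ₛ tail f *ₛ g`, which leaves distributivity, the scalar
  -- rule for `_•_` and the induction hypothesis for `tail f`.
  *ₛ-assoc : ∀ f g h → (f *ₛ g) *ₛ h ≈ₛ f *ₛ (g *ₛ h)
  *ₛ-assoc f g h zero    = begin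
    (f 0 * g 0 + 0#) * h 0 + 0#   ≈⟨ +-congʳ (*-congʳ (+-identityʳ _)) ⟩
    f 0 * g 0 * h 0 + 0#          ≈⟨ +-congʳ (*-assoc _ _ _) ⟩
    f 0 * (g 0 * h 0) + 0#        ≈⟨ +-congʳ (*-congˡ (+-identityʳ _)) ⟨
    f 0 * (g 0 * h 0 + 0#) + 0#   ∎
  *ₛ-assoc f g h (suc k) = begin
    (f 0 * g 0 + 0#) * h (suc k) + ((f 0 • tail g +ₛ tail f *ₛ g) *ₛ h) k
      ≈⟨ +-cong (*-congʳ (+-identityʳ _)) (*ₛ-distribʳ h (f 0 • tail g) (tail f *ₛ g) k) ⟩
    f 0 * g 0 * h (suc k) + (((f 0 • tail g) *ₛ h) k + ((tail f *ₛ g) *ₛ h) k)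
      ≈⟨ +-congˡ (+-cong (•-*ₛ-assoc (f 0) (tail g) h k) (*ₛ-assoc (tail f) g h k)) ⟩
    f 0 * g 0 * h (suc k) + (f 0 * (tail g *ₛ h) k + (tail f *ₛ (g *ₛ h)) k)
      ≈⟨ solve 5 (λ f₀ g₀ hₖ G F →
           f₀ :* g₀ :* hₖ :+ (f₀ :* G :+ F) := f₀ :* (g₀ :* hₖ :+ G) :+ F)
           refl _ _ _ _ _ ⟩
    (f *ₛ (g *ₛ h)) (suc k) ∎

  -- The mirror image of the defining unfolding, with the tail taken on the right; commutativity
  -- follows by playing the two against each other.
  *ₛ-tailʳ : ∀ f g k → (f *ₛ g) (suc k) ≈ f (suc k) * g 0 + (f *ₛ tail g) k
  *ₛ-tailʳ f g zero    =
    solve 5 (λ f₀ f₁ g₀ g₁ z → f₀ :* g₁ :+ (f₁ :* g₀ :+ z) := f₁ :* g₀ :+ (f₀ :* g₁ :+ z))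
      refl _ _ _ _ _
  *ₛ-tailʳ f g (suc k) = begin
    f 0 * g (suc (suc k)) + (tail f *ₛ g) (suc k)
      ≈⟨ +-congˡ (*ₛ-tailʳ (tail f) g k) ⟩
    f 0 * g (suc (suc k)) + (f (suc (suc k)) * g 0 + (tail f *ₛ tail g) k)
      ≈⟨ solve 3 (λ x y z → x :+ (y :+ z) := y :+ (x :+ z)) refl _ _ _ ⟩
    f (suc (suc k)) * g 0 + (f *ₛ tail g) (suc k) ∎

  *ₛ-comm : ∀ f g → f *ₛ g ≈ₛ g *ₛ f
  *ₛ-comm f g zero    = +-congʳ (*-comm _ _)
  *ₛ-comm f g (suc k) = begin
    f 0 * g (suc k) + (tail f *ₛ g) k   ≈⟨ +-cong (*-comm _ _) (*ₛ-comm (tail f) g k) ⟩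
    g (suc k) * f 0 + (g *ₛ tail f) k   ≈⟨ *ₛ-tailʳ g f k ⟨
    (g *ₛ f) (suc k)                    ∎

  const-*ₛ : ∀ a f → const a *ₛ f ≈ₛ a • f
  const-*ₛ a f zero    = +-identityʳ _
  const-*ₛ a f (suc k) = trans (+-congˡ (*ₛ-zeroˡ (λ _ → refl) f k)) (+-identityʳ _)

  *ₛ-identityˡ : ∀ f → 1ₛ *ₛ f ≈ₛ f
  *ₛ-identityˡ f k = trans (const-*ₛ 1# f k) (*-identityˡ _)

  seriesCommutativeRing : CommutativeRing c ℓ
  seriesCommutativeRing = record
    { _≈_ = _≈ₛ_ ; _+_ = _+ₛ_ ; _*_ = _*ₛ_ ; -_ = -ₛ_ ; 0# = 0ₛ ; 1# = 1ₛ
    ; isCommutativeRing = record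
      { isRing = record
        { +-isAbelianGroup = record
          { isGroup = record
            { isMonoid = record
              { isSemigroup = record
                { isMagma = record
                  { isEquivalence = record
                    { refl  = λ _ → refl
                    ; sym   = λ p k → sym (p k)
                    ; trans = λ p q k → trans (p k) (q k)
                    }
                  ; ∙-cong = λ p q k → +-cong (p k) (q k)
                  }
                ; assoc = λ f g h k → +-assoc (f k) (g k) (h k)
                }
              ; identity =
                  (λ f k → trans (+-congʳ (0ₛ-coefficient k)) (+-identityˡ (f k)))
                , (λ f k → trans (+-congˡ (0ₛ-coefficient k)) (+-identityʳ (f k)))
              }
            ; inverse =
                (λ f k → trans (-‿inverseˡ (f k)) (sym (0ₛ-coefficient k)))
              , (λ f k → trans (-‿inverseʳ (f k)) (sym (0ₛ-coefficient k)))
            ; ⁻¹-cong = λ p k → -‿cong (p k)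
            }
          ; comm = λ f g k → +-comm (f k) (g k)
          }
        ; *-cong     = *ₛ-cong
        ; *-assoc    = *ₛ-assoc
        ; *-identity = *ₛ-identityˡ , λ f k → trans (*ₛ-comm f 1ₛ k) (*ₛ-identityˡ f k)
        ; distrib    =
            (λ f g h k → trans (*ₛ-comm f (g +ₛ h) k)
              (trans (*ₛ-distribʳ f g h k) (+-cong (*ₛ-comm g f k) (*ₛ-comm h f k))))
          , *ₛ-distribʳ
        }
      ; *-comm = *ₛ-comm
      }
    }

  module S = CommutativeRing seriesCommutativeRing

  -- Constants and multiplication by a monomial of degree one.

  const-* : ∀ a b → const (a * b) ≈ₛ const a *ₛ const b
  const-* a b zero    = sym (+-identityʳ _)
  const-* a b (suc k) = sym (trans (const-*ₛ a (const b) (suc k)) (zeroʳ a))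

  const-^ : ∀ a n → const (SemiringExponentiation._^_ semiring a n) ≈ₛ const a ^ₛ n
  const-^ a zero    = S.refl
  const-^ a (suc n) = S.trans (const-* a _) (*ₛ-congˡ (const a) (const-^ a n))

  tail-X : tail X ≈ₛ 1ₛ
  tail-X zero    = refl
  tail-X (suc k) = refl

  -- With `monomial-suc` this describes multiplication by `const a *ₛ X` as a scaled shift, which
  -- makes the first-step equations recursive in the index.
  monomial-zero : ∀ a f → (const a *ₛ X *ₛ f) 0 ≈ 0#
  monomial-zero a f = begin
    (const a *ₛ X) 0 * f 0 + 0#   ≈⟨ +-identityʳ _ ⟩
    (const a *ₛ X) 0 * f 0        ≈⟨ *-congʳ (trans (const-*ₛ a X 0) (zeroʳ a)) ⟩
    0# * f 0                      ≈⟨ zeroˡ _ ⟩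
    0#                            ∎

  monomial-suc : ∀ a f k → (const a *ₛ X *ₛ f) (suc k) ≈ a * f k
  monomial-suc a f k = begin
    (const a *ₛ X *ₛ f) (suc k)             ≈⟨ *ₛ-assoc (const a) X f (suc k) ⟩
    (const a *ₛ (X *ₛ f)) (suc k)           ≈⟨ const-*ₛ a (X *ₛ f) (suc k) ⟩
    a * (0# * f (suc k) + (tail X *ₛ f) k)  ≈⟨ *-congˡ (+-cong (zeroˡ _) (*ₛ-congʳ f tail-X k)) ⟩
    a * (0# + (1ₛ *ₛ f) k)                  ≈⟨ *-congˡ (trans (+-identityˡ _) (*ₛ-identityˡ f k)) ⟩
    a * f k                                 ∎

  -- Closure properties of polynomials.

  const-polynomial : ∀ a → IsPolynomial (const a)
  const-polynomial a = 1 , λ { zero () ; (suc k) _ → refl }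

  X-polynomial : IsPolynomial X
  X-polynomial = 2 , λ { zero () ; (suc zero) (s≤s ()) ; (suc (suc k)) _ → refl }

  -ₛ-polynomial : IsPolynomial f → IsPolynomial g → IsPolynomial (f -ₛ g)
  -ₛ-polynomial (d , f≈0) (e , g≈0) = d ℕ.+ e , λ k d+e≤k →
    trans (+-cong (f≈0 k (ℕ.m+n≤o⇒m≤o d d+e≤k)) (-‿cong (g≈0 k (ℕ.m+n≤o⇒n≤o d d+e≤k))))
      (-‿inverseʳ 0#)

  *ₛ-polynomial : IsPolynomial f → IsPolynomial g → IsPolynomial (f *ₛ g)
  *ₛ-polynomial {f} {g} (d , f≈0) (e , g≈0) = d ℕ.+ e , vanish d f f≈0
    where
    -- Induction on the bound of the left factor: `tail f` has bound one less, and the split-off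
    -- term `f 0 * g (suc k)` vanishes because `suc k` is past the bound `e` of `g`.
    vanish : ∀ d f → (∀ k → d ℕ.≤ k → f k ≈ 0#) → ∀ k → d ℕ.+ e ℕ.≤ k → (f *ₛ g) k ≈ 0#
    vanish zero    f f≈0 k       _         = *ₛ-zeroˡ (λ i → f≈0 i z≤n) g k
    vanish (suc d) f f≈0 (suc k) (s≤s d+e≤k) = begin
      f 0 * g (suc k) + (tail f *ₛ g) k
        ≈⟨ +-cong (*-congˡ (g≈0 (suc k) (ℕ.m≤n⇒m≤1+n (ℕ.m+n≤o⇒n≤o d d+e≤k))))
                  (vanish d (tail f) (λ i d≤i → f≈0 (suc i) (s≤s d≤i)) k d+e≤k) ⟩
      f 0 * 0# + 0#  ≈⟨ trans (+-identityʳ _) (zeroʳ _) ⟩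
      0#             ∎

  ^ₛ-polynomial : IsPolynomial f → ∀ n → IsPolynomial (f ^ₛ n)
  ^ₛ-polynomial f-poly zero    = const-polynomial 1#
  ^ₛ-polynomial f-poly (suc n) = *ₛ-polynomial f-poly (^ₛ-polynomial f-poly n)

-- Conditioning on the first turn.

module FirstStep {c ℓ₁ ℓ₂ ℓ₃} (K : OrderedField c ℓ₁ ℓ₂ ℓ₃)
                 (u : ℕ) (p : OrderedField.Carrier K) where
  open OrderedField K hiding (_<_; _≤_)
  open PileGame K u p

  private
    coefficientRing : CommutativeRing c ℓ₁
    coefficientRing = HeytingCommutativeRing.commutativeRing heytingCommutativeRing

  open SeriesRing coefficientRing public
  open SemiringSolver S.commutativeSemiring using (solve; _:=_; _:+_; _:*_)

  Y Z : Series
  Y = const p *ₛ X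
  Z = const q *ₛ X

  total : ∀ {A : Set} → (A → Carrier) → List A → Carrier
  total f xs = List.foldr _+_ 0# (List.map f xs)

  total-++ : ∀ {A : Set} (f : A → Carrier) xs ys → total f (xs ++ ys) ≈ total f xs + total f ys
  total-++ f []       ys = sym (+-identityˡ _)
  total-++ f (x ∷ xs) ys = trans (+-congˡ (total-++ f xs ys)) (sym (+-assoc _ _ _))

  total-scale : ∀ {A : Set} {f g : A → Carrier} a → (∀ x → f x ≈ a * g x) →
                ∀ xs → total f xs ≈ a * total g xs
  total-scale a f≈ag []       = sym (zeroʳ a)
  total-scale a f≈ag (x ∷ xs) =
    trans (+-cong (f≈ag x) (total-scale a f≈ag xs)) (sym (distribˡ a _ _))

  if-scale : ∀ a x (b : Bool) → (if b then a * x else 0#) ≈ a * (if b then x else 0#)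
  if-scale a x true  = refl
  if-scale a x false = sym (zeroʳ a)

  -- `choices (suc k)` consists of the sequences starting with `gain` followed by those starting
  -- with `lose`, and the weight of the first choice factors out of each half.
  Pr-suc : ∀ k (E : Vec Choice (suc k) → Bool) →
           Pr (suc k) E ≈ p * Pr k (λ w → E (gain ∷ w)) + q * Pr k (λ w → E (lose ∷ w))
  Pr-suc k E = trans (total-++ term (List.map (gain ∷_) ws) _) (+-cong (branch gain) (branch lose))
    where
    ws : List (Vec Choice k)
    ws = choices k

    term : Vec Choice (suc k) → Carrier
    term w = if E w then probability w else 0#

    branch : ∀ x → total term (List.map (x ∷_) ws) ≈ weight x * Pr k (λ w → E (x ∷ w))
    branch x = trans (reflexive (≡.cong (List.foldr _+_ 0#) (≡.sym (map-∘ ws))))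
      (total-scale (weight x) (λ w → if-scale (weight x) (probability w) (E (x ∷ w))) ws)

  Pr-false : ∀ k → Pr k (λ _ → false) ≈ 0#
  Pr-false k =
    trans (total-scale {g = λ _ → 0#} 0# (λ _ → sym (zeroˡ 0#)) (choices k)) (zeroˡ _)

  -- The first-step equations and uniqueness of their solutions.

  not-yet-ended : ℕ → ℕ → Bool
  not-yet-ended n s = not (does (s ℕ.≟ n))

  -- The comparison of `s` with `n` stays unevaluated, so that `G-end` and `G-solves` can each
  -- rewrite by its outcome.
  G-suc : ∀ n s k → G n s (suc k) ≈
          p * Pr k (λ w → not-yet-ended n s ∧ endsAfter n (suc s) w) +
          q * Pr k (λ w → not-yet-ended n s ∧ endsAfter n (s ∸ u) w)
  G-suc n s k = Pr-suc k (endsAfter n s)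

  G-end : ∀ n → G n n ≈ₛ 1ₛ
  G-end n zero    rewrite dec-true (n ℕ.≟ n) ≡.refl = +-identityʳ 1#
  G-end n (suc k) = trans (G-suc n n k) ended
    where
    ended : p * Pr k (λ w → not-yet-ended n n ∧ endsAfter n (suc n) w) +
            q * Pr k (λ w → not-yet-ended n n ∧ endsAfter n (n ∸ u) w) ≈ 0#
    ended rewrite dec-true (n ℕ.≟ n) ≡.refl =
      trans (+-cong (trans (*-congˡ (Pr-false k)) (zeroʳ p))
                    (trans (*-congˡ (Pr-false k)) (zeroʳ q)))
        (+-identityˡ 0#)

  -- An arbitrary family `F` is allowed so that multiples of `G n` can be compared with explicit
  -- candidates. No equation is imposed at `n`, where the boundary value sits.
  SolvesFirstStep : ℕ → (ℕ → Series) → Set ℓ₁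
  SolvesFirstStep n F = ∀ s → s ℕ.< n → F s ≈ₛ Y *ₛ F (suc s) +ₛ Z *ₛ F (s ∸ u)

  first-step-zero : ∀ f g → (Y *ₛ f +ₛ Z *ₛ g) 0 ≈ 0#
  first-step-zero f g =
    trans (+-cong (monomial-zero p f) (monomial-zero q g)) (+-identityˡ 0#)

  first-step-suc : ∀ f g k → (Y *ₛ f +ₛ Z *ₛ g) (suc k) ≈ p * f k + q * g k
  first-step-suc f g k = +-cong (monomial-suc p f k) (monomial-suc q g k)

  G-solves : ∀ n → SolvesFirstStep n (G n)
  G-solves n s s<n zero =
    trans no-end (sym (first-step-zero (G n (suc s)) (G n (s ∸ u))))
    where
    no-end : G n s 0 ≈ 0#
    no-end rewrite dec-false (s ℕ.≟ n) (ℕ.<⇒≢ s<n) = +-identityʳ 0#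
  G-solves n s s<n (suc k) =
    trans (trans (G-suc n s k) not-ended)
      (sym (first-step-suc (G n (suc s)) (G n (s ∸ u)) k))
    where
    not-ended : p * Pr k (λ w → not-yet-ended n s ∧ endsAfter n (suc s) w) +
                q * Pr k (λ w → not-yet-ended n s ∧ endsAfter n (s ∸ u) w) ≈
                p * G n (suc s) k + q * G n (s ∸ u) k
    not-ended rewrite dec-false (s ℕ.≟ n) (ℕ.<⇒≢ s<n) = refl

  solution-zero : ∀ {n} F → SolvesFirstStep n F → ∀ s → s ℕ.< n → F s 0 ≈ 0#
  solution-zero F F-solves s s<n =
    trans (F-solves s s<n 0) (first-step-zero (F (suc s)) (F (s ∸ u)))

  solution-suc : ∀ {n} F → SolvesFirstStep n F → ∀ s → s ℕ.< n → ∀ k →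
                 F s (suc k) ≈ p * F (suc s) k + q * F (s ∸ u) k
  solution-suc F F-solves s s<n k =
    trans (F-solves s s<n (suc k)) (first-step-suc (F (suc s)) (F (s ∸ u)) k)

  -- Coefficient `suc k` at `s` depends only on coefficients `k` at `suc s` and `s ∸ u`. Hence the
  -- induction is on `k`, for all `s` at once, and needs no order on the positions.
  solution-unique : ∀ {n} F F′ → SolvesFirstStep n F → SolvesFirstStep n F′ →
                    F n ≈ₛ F′ n → ∀ s → s ℕ.≤ n → F s ≈ₛ F′ s
  solution-unique {n} F F′ F-solves F′-solves Fn≈F′n s s≤n k = agree k s s≤n
    where
    agree : ∀ k s → s ℕ.≤ n → F s k ≈ F′ s k
    agree k s s≤n with ℕ.m≤n⇒m<n∨m≡n s≤n
    agree k       s s≤n | inj₂ ≡.refl = Fn≈F′n k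
    agree zero    s s≤n | inj₁ s<n =
      trans (solution-zero F F-solves s s<n) (sym (solution-zero F′ F′-solves s s<n))
    agree (suc k) s s≤n | inj₁ s<n = begin
      F s (suc k)                        ≈⟨ solution-suc F F-solves s s<n k ⟩
      p * F (suc s) k + q * F (s ∸ u) k  ≈⟨ +-cong (*-congˡ (agree k (suc s) s<n))
                                              (*-congˡ (agree k (s ∸ u) (ℕ.≤-trans (ℕ.m∸n≤m s u) s≤n))) ⟩
      p * F′ (suc s) k + q * F′ (s ∸ u) k ≈⟨ solution-suc F′ F′-solves s s<n k ⟨
      F′ s (suc k)                       ∎
      where open ≈-Reasoning setoid

  -- The denominators.

  -- history n d is D (n ∸ d); keeping all earlier values makes the recursion
  -- structural.
  history : ℕ → ℕ → Series
  history zero    d       = 1ₛ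
  history (suc n) zero    = history n 0 -ₛ Z *ₛ Y ^ₛ (n ∸ (n ∸ u)) *ₛ history n u
  history (suc n) (suc d) = history n d

  D : ℕ → Series
  D n = history n 0

  -- The value `1ₛ` of `history zero` at every `d` matches truncated subtraction, so the case of `d`
  -- beyond `n` is covered as well.
  history≡D : ∀ n d → history n d ≡ D (n ∸ d)
  history≡D zero    zero    = ≡.refl
  history≡D zero    (suc d) = ≡.refl
  history≡D (suc n) zero    = ≡.refl
  history≡D (suc n) (suc d) = history≡D n d

  -- The exponent `n ∸ (n ∸ u)` counts the chips actually lost from a pile of `n`: it is `u`, or `n`
  -- if the pile is smaller.
  D-suc : ∀ n → D (suc n) ≈ₛ D n -ₛ Z *ₛ Y ^ₛ (n ∸ (n ∸ u)) *ₛ D (n ∸ u)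
  D-suc n rewrite history≡D n u = S.refl

  -- Moving the negative term across brings the recurrence to the shape of a first-step equation,
  -- within reach of the semiring solver.
  D-step : ∀ n → D n ≈ₛ D (suc n) +ₛ Z *ₛ Y ^ₛ (n ∸ (n ∸ u)) *ₛ D (n ∸ u)
  D-step n = S.sym (S.trans (S.+-congʳ (D-suc n)) (//-rightDividesˡ _ (D n)))
    where open GroupProperties S.+-group using (//-rightDividesˡ)

  -- Each subtracted term contains the factor `Z` and so has no constant term. This is what shows
  -- that `D n` is a legitimate denominator.
  D-constant-term : ∀ n → D n 0 ≈ 1#
  D-constant-term zero    = refl
  D-constant-term (suc n) = begin
    D n 0 - (Z *ₛ Y ^ₛ e *ₛ H) 0      ≈⟨ +-cong (D-constant-term n) (-‿cong (*ₛ-assoc Z (Y ^ₛ e) H 0)) ⟩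
    1# - (Z *ₛ (Y ^ₛ e *ₛ H)) 0       ≈⟨ +-congˡ (-‿cong (monomial-zero q (Y ^ₛ e *ₛ H))) ⟩
    1# - 0#                           ≈⟨ x-0≈x 1# ⟩
    1#                                ∎
    where
    open ≈-Reasoning setoid
    open HeytingProperties heytingCommutativeRing using (x-0≈x)
    e = n ∸ (n ∸ u)
    H = history n u

  Y-polynomial : IsPolynomial Y
  Y-polynomial = *ₛ-polynomial (const-polynomial p) X-polynomial

  history-polynomial : ∀ n d → IsPolynomial (history n d)
  history-polynomial zero    d       = const-polynomial 1#
  history-polynomial (suc n) zero    =
    -ₛ-polynomial (history-polynomial n 0)
      (*ₛ-polynomial
        (*ₛ-polynomial (*ₛ-polynomial (const-polynomial q) X-polynomial)
                       (^ₛ-polynomial Y-polynomial (n ∸ (n ∸ u))))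
        (history-polynomial n u))
  history-polynomial (suc n) (suc d) = history-polynomial n d

  -- The numerators and the normalized representation.

  N : ℕ → ℕ → Series
  N n s = Y ^ₛ (n ∸ s) *ₛ D s

  N-solves : ∀ n → SolvesFirstStep n (N n)
  N-solves n s s<n = begin
    Y ^ₛ (n ∸ s) *ₛ D s
      ≈⟨ S.*-cong (S.reflexive (≡.cong (Y ^ₛ_) n∸s≡1+m)) (D-step s) ⟩
    (Y *ₛ Y ^ₛ m) *ₛ (D (suc s) +ₛ Z *ₛ Y ^ₛ e *ₛ D (s ∸ u))
      ≈⟨ solve 6
           (λ y yᵐ d z yᵉ d′ → (y :* yᵐ) :* (d :+ z :* yᵉ :* d′)
              := y :* (yᵐ :* d) :+ z :* ((y :* yᵐ :* yᵉ) :* d′))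
           S.refl Y (Y ^ₛ m) (D (suc s)) Z (Y ^ₛ e) (D (s ∸ u)) ⟩
    Y *ₛ (Y ^ₛ m *ₛ D (suc s)) +ₛ Z *ₛ ((Y ^ₛ suc m *ₛ Y ^ₛ e) *ₛ D (s ∸ u))
      ≈⟨ S.+-congˡ (*ₛ-congˡ Z (*ₛ-congʳ (D (s ∸ u)) (S.sym (^-homo-* Y (suc m) e)))) ⟩
    Y *ₛ N n (suc s) +ₛ Z *ₛ (Y ^ₛ (suc m ℕ.+ e) *ₛ D (s ∸ u))
      ≈⟨ S.+-congˡ (*ₛ-congˡ Z (*ₛ-congʳ (D (s ∸ u)) (S.reflexive (≡.cong (Y ^ₛ_) exponent)))) ⟩
    Y *ₛ N n (suc s) +ₛ Z *ₛ N n (s ∸ u) ∎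
    where
    open ≈-Reasoning S.setoid
    open SemiringExponentiation S.semiring using (^-homo-*)
    m e : ℕ
    m = n ∸ suc s
    e = s ∸ (s ∸ u)

    n∸s≡1+m : n ∸ s ≡ suc m
    n∸s≡1+m = ℕ.+-∸-assoc 1 s<n

    -- The gaps from `s ∸ u` to `s` and from `s` to `n` add up to the gap from `s ∸ u` to `n`. With
    -- the truncated exponent this also holds when `s` is below `u`.
    exponent : suc m ℕ.+ e ≡ n ∸ (s ∸ u)
    exponent =
      ≡.trans (≡.cong (ℕ._+ e) (≡.sym n∸s≡1+m))
        (≡.trans (≡.sym (ℕ.+-∸-assoc (n ∸ s) (ℕ.m∸n≤m s u)))
          (≡.cong (_∸ (s ∸ u)) (ℕ.m∸n+n≡m (ℕ.<⇒≤ s<n))))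

  -- The first-step equations are linear and homogeneous, so a common factor preserves them.
  DG-solves : ∀ n → SolvesFirstStep n (λ s → D n *ₛ G n s)
  DG-solves n s s<n = S.trans (*ₛ-congˡ (D n) (G-solves n s s<n))
    (solve 5 (λ d y g z g′ → d :* (y :* g :+ z :* g′) := y :* (d :* g) :+ z :* (d :* g′))
      S.refl (D n) Y (G n (suc s)) Z (G n (s ∸ u)))

  D*G≈N : ∀ n s → s ℕ.≤ n → D n *ₛ G n s ≈ₛ N n s
  D*G≈N n = solution-unique (λ s → D n *ₛ G n s) (N n) (DG-solves n) (N-solves n) (begin
    D n *ₛ G n n         ≈⟨ *ₛ-congˡ (D n) (G-end n) ⟩
    D n *ₛ 1ₛ            ≈⟨ S.*-comm (D n) 1ₛ ⟩
    1ₛ *ₛ D n            ≡⟨ ≡.cong (λ i → Y ^ₛ i *ₛ D n) (≡.sym (ℕ.n∸n≡0 n)) ⟩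
    Y ^ₛ (n ∸ n) *ₛ D n  ∎)
    where open ≈-Reasoning S.setoid

  D≉0 : ∀ n → ¬ (D n ≈ₛ 0ₛ)
  D≉0 n D≈0 = #-irrefl (trans (sym (D-constant-term n)) (D≈0 0)) 1#0
    where open HeytingProperties heytingCommutativeRing using (1#0)

  N-normalized : ∀ n → N n 0 ≈ₛ Y ^ₛ n
  N-normalized n = S.*-identityʳ (Y ^ₛ n)

  representation : IsNormalizedRepresentation N D
  representation = record
    { numerator-polynomial   = λ n s _ →
        *ₛ-polynomial (^ₛ-polynomial Y-polynomial (n ∸ s)) (history-polynomial s 0)
    ; denominator-polynomial = λ n → history-polynomial n 0
    ; fraction               = λ n s s≤n → D≉0 n , D*G≈N n s s≤n
    ; normalized             = N-normalized
    }

  -- Cancelling powers of `Y`; uniqueness of the denominator.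

  module _ (p#0 : p # 0#) where

    p*-cancel : ∀ {x y} → p * x ≈ p * y → x ≈ y
    p*-cancel {x} {y} px≈py with #⇒invertible p#0
    ... | p⁻¹ , p⁻¹[p-0]≈1 , _ = begin
      x              ≈⟨ cancel x ⟨
      p⁻¹ * (p * x)  ≈⟨ *-congˡ px≈py ⟩
      p⁻¹ * (p * y)  ≈⟨ cancel y ⟩
      y              ∎
      where
      open ≈-Reasoning setoid
      open HeytingProperties heytingCommutativeRing using (x-0≈x)
      cancel : ∀ z → p⁻¹ * (p * z) ≈ z
      -- The Heyting field supplies an inverse of the difference `p - 0#`, so `p` is first replaced
      -- by that.
      cancel z = trans (sym (*-assoc p⁻¹ p z))
        (trans (*-congʳ (trans (*-congˡ (sym (x-0≈x p))) p⁻¹[p-0]≈1)) (*-identityˡ z))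

    -- Coefficient `suc k` of `Y *ₛ f` is `p * f k`, so cancelling `p` recovers every coefficient of
    -- `f`.
    Y*-cancel : ∀ {f g} → Y *ₛ f ≈ₛ Y *ₛ g → f ≈ₛ g
    Y*-cancel {f} {g} Yf≈Yg k =
      p*-cancel (trans (sym (monomial-suc p f k)) (trans (Yf≈Yg (suc k)) (monomial-suc p g k)))

    Y^-cancel : ∀ n {f g} → Y ^ₛ n *ₛ f ≈ₛ Y ^ₛ n *ₛ g → f ≈ₛ g
    Y^-cancel zero    {f} {g} eq = S.trans (S.sym (S.*-identityˡ f)) (S.trans eq (S.*-identityˡ g))
    Y^-cancel (suc n) {f} {g} eq = Y^-cancel n (Y*-cancel
      (S.trans (S.sym (S.*-assoc Y (Y ^ₛ n) f)) (S.trans eq (S.*-assoc Y (Y ^ₛ n) g))))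

    denominator-unique : ∀ {P Q} → IsNormalizedRepresentation P Q → ∀ n → Q n ≈ₛ D n
    denominator-unique {P} {Q} rep n = Y^-cancel n (begin
      Y ^ₛ n *ₛ Q n           ≈⟨ *ₛ-congʳ (Q n) (S.trans (D*G≈N n 0 z≤n) (N-normalized n)) ⟨
      (D n *ₛ G n 0) *ₛ Q n   ≈⟨ solve 3 (λ d g q → (d :* g) :* q := (q :* g) :* d)
                                   S.refl (D n) (G n 0) (Q n) ⟩
      (Q n *ₛ G n 0) *ₛ D n   ≈⟨ *ₛ-congʳ (D n) (S.trans (proj₂ (fraction n 0 z≤n)) (normalized n)) ⟩
      Y ^ₛ n *ₛ D n           ∎)
      where
      open ≈-Reasoning S.setoid
      open IsNormalizedRepresentation rep

  -- The recurrence with explicit coefficients.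

  Z*Y^ : ∀ m → Z *ₛ Y ^ₛ m ≈ₛ const (q * p ^ m) *ₛ X ^ₛ (m ℕ.+ 1)
  Z*Y^ m = begin
    Z *ₛ Y ^ₛ m
      ≈⟨ *ₛ-congˡ Z (^-distrib-* (const p) X m) ⟩
    (const q *ₛ X) *ₛ (const p ^ₛ m *ₛ X ^ₛ m)
      ≈⟨ solve 4 (λ a x b y → (a :* x) :* (b :* y) := (a :* b) :* (x :* y))
           S.refl (const q) X (const p ^ₛ m) (X ^ₛ m) ⟩
    (const q *ₛ const p ^ₛ m) *ₛ X ^ₛ suc m
      ≈⟨ *ₛ-congʳ (X ^ₛ suc m) (S.trans (const-* q (p ^ m)) (*ₛ-congˡ (const q) (const-^ p m))) ⟨
    const (q * p ^ m) *ₛ X ^ₛ suc m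
      ≡⟨ ≡.cong (λ i → const (q * p ^ m) *ₛ X ^ₛ i) (ℕ.+-comm 1 m) ⟩
    const (q * p ^ m) *ₛ X ^ₛ (m ℕ.+ 1) ∎
    where
    open ≈-Reasoning S.setoid
    open Exponentiation S.commutativeSemiring using (^-distrib-*)

  -- Here `n ∸ 1` is at least `u`, so no truncation occurs and the exponent of `Y` in `D-suc` is
  -- exactly `u`.
  D-recurrence : ∀ n → u ℕ.+ 1 ℕ.≤ n →
    D n ≈ₛ D (n ∸ 1) -ₛ const (q * p ^ u) *ₛ X ^ₛ (u ℕ.+ 1) *ₛ D (n ∸ u ∸ 1)
  -- `u ℕ.+ 1` does not reduce for a variable `u`; commuting the sum exposes a successor, which
  -- refutes the bound.
  D-recurrence zero    u+1≤0 with () ← ≡.subst (ℕ._≤ 0) (ℕ.+-comm u 1) u+1≤0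
  D-recurrence (suc n) u+1≤1+n = begin
    D (suc n)
      ≈⟨ D-suc n ⟩
    D n -ₛ Z *ₛ Y ^ₛ (n ∸ (n ∸ u)) *ₛ D (n ∸ u)
      ≡⟨ ≡.cong₂ (λ i j → D n -ₛ Z *ₛ Y ^ₛ i *ₛ D j) (ℕ.m∸[m∸n]≡n u≤n) index ⟩
    D n -ₛ Z *ₛ Y ^ₛ u *ₛ D (suc n ∸ u ∸ 1)
      ≈⟨ S.+-congˡ {D n} (S.-‿cong (*ₛ-congʳ (D (suc n ∸ u ∸ 1)) (Z*Y^ u))) ⟩
    D n -ₛ const (q * p ^ u) *ₛ X ^ₛ (u ℕ.+ 1) *ₛ D (suc n ∸ u ∸ 1) ∎
    where
    open ≈-Reasoning S.setoid
    u≤n : u ℕ.≤ n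
    u≤n = ℕ.s≤s⁻¹ (≡.subst (ℕ._≤ suc n) (ℕ.+-comm u 1) u+1≤1+n)

    index : n ∸ u ≡ suc n ∸ u ∸ 1
    index = ≡.sym (≡.trans (ℕ.∸-+-assoc (suc n) u 1) (≡.cong (suc n ∸_) (ℕ.+-comm u 1)))

corollary10 : ∀ {c ℓ₁ ℓ₂ ℓ₃} (K : OrderedField c ℓ₁ ℓ₂ ℓ₃) →
    let open OrderedField K in
    (u : ℕ) → 1 ℕ.≤ u →
    (p : Carrier) → 0# < p → p ≤ 1# →
    let open PileGame K u p in
    (∃[ P ] ∃[ Q ] IsNormalizedRepresentation P Q)
    ×
    (∀ P Q → IsNormalizedRepresentation P Q →
    ∀ n → u ℕ.+ 1 ℕ.≤ n →
    Q n ≈ₛ Q (n ∸ 1) -ₛ const (q * p ^ u) *ₛ X ^ₛ (u ℕ.+ 1) *ₛ Q (n ∸ u ∸ 1))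
corollary10 K u _ p 0<p _ = (N , D , representation) , λ P Q rep n u+1≤n →
  let Q≈D = denominator-unique p#0 rep in
  S.trans (Q≈D n) (S.trans (D-recurrence n u+1≤n)
    (S.+-cong (S.sym (Q≈D (n ∸ 1))) (S.-‿cong (*ₛ-congˡ (const (q * p ^ u) *ₛ X ^ₛ (u ℕ.+ 1)) (S.sym (Q≈D (n ∸ u ∸ 1)))))))
  where
  open OrderedField K
  open PileGame K u p
  open FirstStep K u p
  -- Positivity enters as apartness from `0#`, which makes `p` invertible and powers of `Y`
  -- cancellable.
  p#0 : p # 0#
  p#0 = Equivalence.from (#⇔<⊎> p 0#) (inj₂ 0<p)
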